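{- It is decidable whether a given two-dimensional consistent domino-complete substitution $\sigma$ is overlapping. (That is, there is an algorithm which, given as input any consistent domino-complete two-dimensional substitution $\sigma$, correctly decides whether $\sigma$ is overlapping.)
   Context: **Cells and patterns.** Let $\mathcal{A}$ be a finite set of symbols (the alphabet). A $d$-dimensional cell is a pair $c=[v,t]$ with $v\in\mathbb{Z}^d$ (the vector of $c$) and $t\in\mathcal{A}$ (the type of $c$). A $d$-dimensional pattern is a finite set of $d$-dimensional cells with pairwise distinct vectors. Patterns are translated by elements of $\mathbb{Z}^d$ by translating the vectors of their cells. The support of $P$ is $\mathrm{supp}(P)=\{v:[v,t]\in P\}$. A domino is a two-dimensional pattern consisting of two cells with vectors $v,v'$ such that $v'-v\in\{(\pm1,0),(0,\pm1)\}$. **Substitutions.** A $d$-dimensional substitution $\sigma$ on $\mathcal{A}$ consists of a base rule, i.e. a map $\sigma_{\mathrm{base}}$ from $\mathcal{A}$ to the set of $d$-dimensional patterns, and a finite set of concatenation rules $(t,t',u)\mapsto v$ with $t,t'\in\mathcal{A}$, $u,v\in\mathbb{Z}^d$, $u\neq 0$. All substitutions are assumed deterministic: if a rule has left-hand side $(t,t',u)$, then no other rule has left-hand side $(t,t',u)$ or $(t',t,-u)$. For a cell $c=[v,t]$ put $\sigma_{\mathrm{base}}(c)=\sigma_{\mathrm{base}}(t)$. The set of starting patterns of $\sigma$ is $\mathcal{C}_\sigma=\{\{[0,t],[u,t']\} : (t,t',u)\mapsto v \text{ is a rule of } \sigma \text{ for some } v\}$. For cells $c=[u,t]$, $c'=[u',t']$,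 set $\sigma_{\mathrm{rule}}(c,c')=v$ if $(t,t',u'-u)\mapsto v$ is a rule of $\sigma$, $\sigma_{\mathrm{rule}}(c,c')=-v$ if $(t',t,u-u')\mapsto v$ is a rule of $\sigma$, and leave it undefined otherwise. A two-dimensional substitution $\sigma$ is domino-complete if its set of starting patterns is, up to translation, the set of all possible dominoes on $\mathcal{A}$ (every element of $\mathcal{C}_\sigma$ is a domino, and every domino is a translate of an element of $\mathcal{C}_\sigma$). **Paths.** A $\mathcal{C}_\sigma$-path from $c_1$ to $c_n$ is a finite sequence of cells $\gamma=(c_1,\dots,c_n)$ such that $\{c_i,c_{i+1}\}$ is a translate of an element of $\mathcal{C}_\sigma$ for all $1\le i\le n-1$, and such that $c_i=c_j$ whenever $c_i$ and $c_j$ have the same vector. It is a $\mathcal{C}_\sigma$-path of a pattern $P$ if all its cells belong to $P$. A pattern $P$ is $\mathcal{C}_\sigma$-covered if for all $c,c'\in P$ there is a $\mathcal{C}_\sigma$-path of $P$ from $c$ to $c'$. The image vector of $\gamma$ is $\omega_\sigma(\gamma)=\sum_{i=1}^{n-1}\sigma_{\mathrm{rule}}(c_i,c_{i+1})$. **Consistency and overlapping.** Let $P$ be a $\mathcal{C}_\sigma$-covered pattern. $\sigma$ is consistent on $P$ if for all cells $c,c'\in P$ and all $\mathcal{C}_\sigma$-paths $\gamma,\gamma'$ of $P$ from $c$ to $c'$ we have $\omega_\sigma(\gamma)=\omega_\sigma(\gamma')$. $\sigma$ is non-overlapping on $P$ if for all cells $c\neq c'$ of $P$ and every $\mathcal{C}_\sigma$-path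 $\gamma$ of $P$ from $c$ to $c'$ we have $\mathrm{supp}(\sigma_{\mathrm{base}}(c))\cap \mathrm{supp}(\omega_\sigma(\gamma)+\sigma_{\mathrm{base}}(c'))=\varnothing$. $\sigma$ is consistent (resp. non-overlapping) if it is so on every $\mathcal{C}_\sigma$-covered pattern; $\sigma$ is overlapping if it is not non-overlapping. -}

module Defs where

open import Data.Fin.Base using (Fin)
import Data.Fin.Properties as Fin
open import Data.Integer.Base as ℤ using (ℤ; 0ℤ; 1ℤ; -1ℤ)
import Data.Integer.Properties as ℤ
open import Data.List.Base using (List; []; _∷_; map; filter; head; last)
open import Data.List.Membership.Propositional using (_∈_)
open import Data.List.Relation.Binary.BagAndSetEquality using (_∼[_]_; set)
open import Data.List.Relation.Binary.Disjoint.Propositional using (Disjoint)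
open import Data.List.Relation.Binary.Subset.Propositional using (_⊆_)
open import Data.List.Relation.Unary.Linked using (Linked)
open import Data.List.Relation.Unary.Unique.Propositional using (Unique)
open import Data.Maybe.Base as Maybe using (Maybe; just; _<∣>_)
open import Data.Nat.Base using (ℕ)
open import Data.Product.Base using (_×_; _,_; proj₁; proj₂; ∃-syntax)
import Data.Product.Properties as Product
open import Data.Sum.Base using (_⊎_)
open import Data.Vec.Base as Vec using (Vec)
import Data.Vec.Properties as Vec
open import Relation.Binary.Definitions using (DecidableEquality)
open import Relation.Binary.PropositionalEquality.Core using (_≡_; _≢_)
open import Relation.Nullary.Negation.Core using (¬_)

infixl 6 _+ᵥ_ _-ᵥ_

ℤ^_ : ℕ → Set
ℤ^ d = Vec ℤ d

0ᵥ : ∀ {d} → ℤ^ d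
0ᵥ = Vec.replicate _ 0ℤ

_+ᵥ_ : ∀ {d} → ℤ^ d → ℤ^ d → ℤ^ d
_+ᵥ_ = Vec.zipWith ℤ._+_

neg : ∀ {d} → ℤ^ d → ℤ^ d
neg = Vec.map (ℤ.-_)

_-ᵥ_ : ∀ {d} → ℤ^ d → ℤ^ d → ℤ^ d
u -ᵥ v = u +ᵥ neg v

------------------------------------------------------------------------
-- Cells and patterns, in dimension d, over the alphabet Fin k

record Cell (d k : ℕ) : Set where
  constructor [_,_]
  field
    vector : ℤ^ d
    type   : Fin k

open Cell public

-- A finite set of cells is a list considered up to _∼[ set ]_,
-- that is, up to having the same members.
CellSet : (d k : ℕ) → Set
CellSet d k = List (Cell d k)

supp : ∀ {d k} → CellSet d k → List (ℤ^ d)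
supp = map vector

translate : ∀ {d k} → ℤ^ d → CellSet d k → CellSet d k
translate w = map λ c → [ w +ᵥ vector c , type c ]

IsTranslateOf : ∀ {d k} → CellSet d k → CellSet d k → Set
IsTranslateOf S T = ∃[ w ] S ∼[ set ] translate w T

record Pattern (d k : ℕ) : Set where
  field
    cells    : CellSet d k
    distinct : Unique (supp cells)

open Pattern public

IsUnitStep : ℤ^ 2 → Set
IsUnitStep u = u ∈ (1ℤ Vec.∷ 0ℤ Vec.∷ Vec.[]) ∷ (-1ℤ Vec.∷ 0ℤ Vec.∷ Vec.[])
                 ∷ (0ℤ Vec.∷ 1ℤ Vec.∷ Vec.[]) ∷ (0ℤ Vec.∷ -1ℤ Vec.∷ Vec.[]) ∷ []

-- The unit step forces the two vectors to differ, so a domino is a pattern.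
IsDomino : ∀ {k} → CellSet 2 k → Set
IsDomino S = ∃[ c ] ∃[ c′ ] S ∼[ set ] (c ∷ c′ ∷ []) × IsUnitStep (vector c′ -ᵥ vector c)

------------------------------------------------------------------------
-- Substitutions

-- The left-hand side (t , t′ , u) of a concatenation rule.
LHS : (d k : ℕ) → Set
LHS d k = Fin k × Fin k × ℤ^ d

-- The rule (l , v) stands for l ↦ v.
Rule : (d k : ℕ) → Set
Rule d k = LHS d k × ℤ^ d

displacement : ∀ {d k} → Rule d k → ℤ^ d
displacement ((_ , _ , u) , _) = u

opposite : ∀ {d k} → LHS d k → LHS d k
opposite (t , t′ , u) = t′ , t , neg u

_≟ₗ_ : ∀ {d k} → DecidableEquality (LHS d k)
_≟ₗ_ = Product.≡-dec Fin._≟_ (Product.≡-dec Fin._≟_ (Vec.≡-dec ℤ._≟_))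

record Substitution (d k : ℕ) : Set where
  field
    base          : Fin k → Pattern d k
    rules         : List (Rule d k)
    nonzero       : ∀ {r} → r ∈ rules → displacement r ≢ 0ᵥ
    deterministic : ∀ {r r′} → r ∈ rules → r′ ∈ rules →
                    proj₁ r′ ≡ proj₁ r ⊎ proj₁ r′ ≡ opposite (proj₁ r) → r′ ≡ r

startingPattern : ∀ {d k} → Rule d k → CellSet d k
startingPattern ((t , t′ , u) , _) = [ 0ᵥ , t ] ∷ [ u , t′ ] ∷ []

module _ {d k : ℕ} (σ : Substitution d k) where
  open Substitution σ

  startingPatterns : List (CellSet d k)
  startingPatterns = map startingPattern rules

  lookupRule : LHS d k → Maybe (ℤ^ d)
  lookupRule l = Maybe.map proj₂ (head (filter (λ r → proj₁ r ≟ₗ l) rules))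

  -- By determinism at most one of the two alternatives is defined.
  σ-rule : Cell d k → Cell d k → Maybe (ℤ^ d)
  σ-rule [ u , t ] [ u′ , t′ ] =
    lookupRule (t , t′ , u′ -ᵥ u) <∣> Maybe.map neg (lookupRule (t′ , t , u -ᵥ u′))

  Adjacent : Cell d k → Cell d k → Set
  Adjacent c c′ = ∃[ S ] S ∈ startingPatterns × IsTranslateOf (c ∷ c′ ∷ []) S

  record IsPath (c c′ : Cell d k) (γ : List (Cell d k)) : Set where
    field
      starts     : head γ ≡ just c
      ends       : last γ ≡ just c′
      linked     : Linked Adjacent γ
      compatible : ∀ {x y} → x ∈ γ → y ∈ γ → vector x ≡ vector y → x ≡ y

  IsPathOf : Pattern d k → Cell d k → Cell d k → List (Cell d k) → Set
  IsPathOf P c c′ γ = IsPath c c′ γ × γ ⊆ cells P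

  Covered : Pattern d k → Set
  Covered P = ∀ {c c′} → c ∈ cells P → c′ ∈ cells P → ∃[ γ ] IsPathOf P c c′ γ

  -- The image vector; the sum is defined when all its terms are,
  -- which is the case along every path.
  ω : List (Cell d k) → Maybe (ℤ^ d)
  ω []            = just 0ᵥ
  ω (c ∷ [])      = just 0ᵥ
  ω (c ∷ c′ ∷ γ) = Maybe.zipWith _+ᵥ_ (σ-rule c c′) (ω (c′ ∷ γ))

  ConsistentOn : Pattern d k → Set
  ConsistentOn P = ∀ {c c′} → c ∈ cells P → c′ ∈ cells P →
    ∀ {γ γ′} → IsPathOf P c c′ γ → IsPathOf P c c′ γ′ → ω γ ≡ ω γ′

  NonOverlappingOn : Pattern d k → Set
  NonOverlappingOn P = ∀ {c c′} → c ∈ cells P → c′ ∈ cells P → c ≢ c′ →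
    ∀ {γ} → IsPathOf P c c′ γ → ∀ {w} → ω γ ≡ just w →
    Disjoint (supp (cells (base (type c)))) (supp (translate w (cells (base (type c′)))))

  Consistent : Set
  Consistent = ∀ P → Covered P → ConsistentOn P

  NonOverlapping : Set
  NonOverlapping = ∀ P → Covered P → NonOverlappingOn P

  Overlapping : Set
  Overlapping = ¬ NonOverlapping

DominoComplete : ∀ {k} → Substitution 2 k → Set
DominoComplete σ =
  (∀ {S} → S ∈ startingPatterns σ → IsDomino S) ×
  (∀ {D} → IsDomino D → ∃[ S ] S ∈ startingPatterns σ × IsTranslateOf D S)

{-# OPTIONS --safe #-}

-- Consistency on the 2 × 2 squares makes the image vector of a path from
-- [ u , t ] to [ u′ , t′ ] equal to A (u′ - u) + q t′ - q t, for a fixed 2 × 2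
-- integer matrix A and a fixed q, whatever the path is.  Any two cells with
-- distinct vectors are joined by a self-avoiding path of dominoes, so σ is
-- overlapping exactly when A z = e has a solution z ≢ 0 for one of the finitely
-- many e = p′ - p + q t′ - q t with p ∈ supp (base t), p′ ∈ supp (base t′).
-- This is decided by Cramer's rule if det A ≢ 0, and by Bézout's identity else.
module Submission where

open import Defs
open import Data.Fin.Base as Fin using (Fin)
import Data.Fin.Properties as Fin
open import Data.Integer.Base
  using (ℤ; +_; -[1+_]; 0ℤ; 1ℤ; -1ℤ; _+_; _-_; _*_; -_; ∣_∣; NonZero; ≢-nonZero)
open import Data.Integer.Divisibility.Signed
  using (_∣_; _∣?_; divides; ∣ᵤ⇒∣; ∣n⇒∣m*n; ∣m∣n⇒∣m+n)
open import Data.Integer.GCD using (gcd; gcd[i,j]∣i; gcd[i,j]∣j)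
open import Data.Integer.Properties
  using (_≟_; i≡j⇒i-j≡0; i-j≡0⇒i≡j; i*j≡0⇒i≡0∨j≡0; *-cancelˡ-≡; pos-+; pos-*;
         *-identityˡ; +-identityʳ; ∣-i∣≡∣i∣)
open import Data.Integer.Tactic.RingSolver using (solve-∀)
open import Data.List.Base using (List; []; _∷_; map; head; last)
open import Data.List.Membership.Propositional using (_∈_; find; lose)
open import Data.List.Membership.Propositional.Properties using (∈-map⁺; ∈-map⁻; ∈-filter⁺)
open import Data.List.Relation.Binary.BagAndSetEquality using (_∼[_]_; set)
open import Data.List.Relation.Binary.Subset.Propositional using (_⊆_)
open import Data.List.Relation.Unary.All as All using ([]; _∷_)
open import Data.List.Relation.Unary.AllPairs as AllPairs using ([]; _∷_)
import Data.List.Relation.Unary.AllPairs.Properties as AllPairs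
open import Data.List.Relation.Unary.Any using (Any; here; there; any?)
open import Data.List.Relation.Unary.Linked as Linked using (Linked; [-]; _∷_)
open import Data.List.Relation.Unary.Linked.Properties using (Linked⇒AllPairs)
open import Data.List.Relation.Unary.Unique.Propositional using (Unique)
open import Data.Maybe.Base as Maybe using (Maybe; just; nothing; _<∣>_)
open import Data.Maybe.Properties using (just-injective)
open import Data.Nat.Base as ℕ using (ℕ; zero; suc)
import Data.Nat.GCD as ℕ
open import Data.Nat.Induction using (<-wellFounded)
import Data.Nat.Properties as ℕ
open import Data.Product.Base using (_×_; _,_; proj₁; proj₂; ∃₂; ∃-syntax)
open import Data.Sum.Base using (_⊎_; inj₁; inj₂; [_,_]′)
open import Data.Vec.Base using ([]; _∷_)
open import Data.Vec.Properties using (∷-injectiveˡ; ∷-injectiveʳ)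
open import Function.Base using (_∘_; id; _on_)
open import Function.Bundles using (Equivalence; mk⇔)
open import Induction.WellFounded using (Acc; acc)
open import Relation.Binary.Construct.Closure.ReflexiveTransitive
  using (Star; ε; _◅_; _◅◅_; gmap; reverse)
open import Relation.Binary.PropositionalEquality hiding ([_])
open import Relation.Nullary using (¬_; contradiction)
open import Relation.Nullary.Decidable using (yes; no; map′; _×-dec_)
open import Relation.Nullary.Decidable.Core using (Dec)

-- Integer linear systems

-- The sign is kept as an integer factor, so that a Bézout identity between absolute values becomes
-- one between the integers themselves.
∣i∣≡s*i : ∀ i → ∃[ s ] + ∣ i ∣ ≡ s * i
∣i∣≡s*i (+ n)    = 1ℤ , sym (*-identityˡ (+ n))
∣i∣≡s*i -[1+ n ] = -1ℤ , eq (+ (suc n))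
  where
  eq : ∀ i → i ≡ -1ℤ * (- i)
  eq = solve-∀

pos-identity : ∀ d y n x m → d ℕ.+ y ℕ.* n ≡ x ℕ.* m → + d + + y * + n ≡ + x * + m
pos-identity d y n x m eq = begin
  + d + + y * + n     ≡⟨ cong (λ i → + d + i) (pos-* y n) ⟨
  + d + + (y ℕ.* n)   ≡⟨ pos-+ d (y ℕ.* n) ⟨
  + (d ℕ.+ y ℕ.* n)   ≡⟨ cong +_ eq ⟩
  + (x ℕ.* m)         ≡⟨ pos-* x m ⟩
  + x * + m           ∎
  where open ≡-Reasoning

bézout : ∀ a b → ∃₂ λ x y → x * a + y * b ≡ gcd a b
bézout a b
  with s , ∣a∣≡sa ← ∣i∣≡s*i a | t , ∣b∣≡tb ← ∣i∣≡s*i b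
  with ℕ.Bézout.identity (ℕ.gcd-GCD ∣ a ∣ ∣ b ∣)
... | ℕ.Bézout.+- x y eq = + x * s , - (+ y * t) ,
  -- The claim is recast as a vanishing difference, which is the negative of the difference of the
  -- two sides of `identity`.
  i-j≡0⇒i≡j _ _ (trans (ring (+ x) (+ y) s t a b (gcd a b)) (cong -_ (i≡j⇒i-j≡0 identity)))
  where
  identity : gcd a b + + y * (t * b) ≡ + x * (s * a)
  identity = subst₂ (λ m n → gcd a b + + y * n ≡ + x * m) ∣a∣≡sa ∣b∣≡tb
    (pos-identity _ y (∣ b ∣) x (∣ a ∣) eq)
  ring : ∀ x y s t a b g → (x * s * a + - (y * t) * b) - g ≡ - ((g + y * (t * b)) - x * (s * a))
  ring = solve-∀
... | ℕ.Bézout.-+ x y eq = - (+ x * s) , + y * t ,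
  i-j≡0⇒i≡j _ _ (trans (ring (+ x) (+ y) s t a b (gcd a b)) (cong -_ (i≡j⇒i-j≡0 identity)))
  where
  identity : gcd a b + + x * (s * a) ≡ + y * (t * b)
  identity = subst₂ (λ m n → gcd a b + + x * m ≡ + y * n) ∣a∣≡sa ∣b∣≡tb
    (pos-identity _ x (∣ a ∣) y (∣ b ∣) eq)
  ring : ∀ x y s t a b g → (- (x * s) * a + y * t * b) - g ≡ - ((g + x * (s * a)) - y * (t * b))
  ring = solve-∀

-- The integer combinations of `a` and `b` are exactly the multiples of their gcd.
linear? : ∀ a b e → Dec (∃₂ λ x y → x * a + y * b ≡ e)
linear? a b e = map′ to from (gcd a b ∣? e)
  where
  to : gcd a b ∣ e → ∃₂ λ x y → x * a + y * b ≡ e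
  to (divides q refl) with x , y , eq ← bézout a b =
    q * x , q * y , trans (ring q x y a b) (cong (q *_) eq)
    where
    ring : ∀ q x y a b → q * x * a + q * y * b ≡ q * (x * a + y * b)
    ring = solve-∀
  from : (∃₂ λ x y → x * a + y * b ≡ e) → gcd a b ∣ e
  from (x , y , refl) = ∣m∣n⇒∣m+n (∣n⇒∣m*n x (∣ᵤ⇒∣ (gcd[i,j]∣i a b))) (∣n⇒∣m*n y (∣ᵤ⇒∣ (gcd[i,j]∣j a b)))

NonTrivial : ℤ → ℤ → Set
NonTrivial x y = ¬ (x ≡ 0ℤ × y ≡ 0ℤ)

module _ (a b c d : ℤ) where

  det : ℤ
  det = a * d - b * c

  System : ℤ → ℤ → ℤ → ℤ → Set
  System e f x y = x * a + y * b ≡ e × x * c + y * d ≡ f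

  private
    cramer-x : ∀ x y a b c d →
      x * (a * d - b * c) ≡ (x * a + y * b) * d - (x * c + y * d) * b
    cramer-x = solve-∀
    cramer-y : ∀ x y a b c d →
      y * (a * d - b * c) ≡ (x * c + y * d) * a - (x * a + y * b) * c
    cramer-y = solve-∀
    cofactor-e : ∀ a b c d e f →
      (e * d - f * b) * a + (f * a - e * c) * b ≡ (a * d - b * c) * e
    cofactor-e = solve-∀
    cofactor-f : ∀ a b c d e f →
      (e * d - f * b) * c + (f * a - e * c) * d ≡ (a * d - b * c) * f
    cofactor-f = solve-∀

  -- By Cramer's rule the only rational solution has numerators `e * d - f * b` and `f * a - e * c`
  -- over `det`, so integrality amounts to two divisibilities.
  regular? : ∀ e f → det ≢ 0ℤ → Dec (∃₂ (System e f))
  regular? e f det≢0 = map′ to from ((det ∣? e * d - f * b) ×-dec (det ∣? f * a - e * c))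
    where
    instance
      det-nonZero : NonZero det
      det-nonZero = ≢-nonZero det≢0
    scale : ∀ x y Δ u v → Δ * (x * u + y * v) ≡ (x * Δ) * u + (y * Δ) * v
    scale = solve-∀
    to : (det ∣ e * d - f * b) × (det ∣ f * a - e * c) → ∃₂ (System e f)
    to (divides x eqx , divides y eqy) = x , y ,
      *-cancelˡ-≡ det _ e (trans (scale x y det a b)
        (trans (cong₂ (λ m n → m * a + n * b) (sym eqx) (sym eqy)) (cofactor-e a b c d e f))) ,
      *-cancelˡ-≡ det _ f (trans (scale x y det c d)
        (trans (cong₂ (λ m n → m * c + n * d) (sym eqx) (sym eqy)) (cofactor-f a b c d e f)))
    from : ∃₂ (System e f) → (det ∣ e * d - f * b) × (det ∣ f * a - e * c)
    from (x , y , refl , refl) =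
      divides x (sym (cramer-x x y a b c d)) , divides y (sym (cramer-y x y a b c d))

  -- When the rows are proportional, the first equation fixes the value
  -- of the second left-hand side, so any one solution of it will do.
  row₂-determined : ∀ x y x′ y′ {e f f′} → det ≡ 0ℤ → ¬ (a ≡ 0ℤ × b ≡ 0ℤ) →
    System e f x y → System e f′ x′ y′ → f ≡ f′
  row₂-determined x y x′ y′ det≡0 row₁≢0 (eq , refl) (eq′ , refl) =
    i-j≡0⇒i≡j _ _ (cancel (vanish c (y - y′) a-ring) (vanish d (x′ - x) b-ring))
    where
    δ = (x * c + y * d) - (x′ * c + y′ * d)
    vanish : ∀ {i} p q → i ≡ p * ((x * a + y * b) - (x′ * a + y′ * b)) + q * det → i ≡ 0ℤ
    vanish p q eqᵢ = trans eqᵢ (trans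
      (cong₂ (λ m n → p * m + q * n) (i≡j⇒i-j≡0 (trans eq (sym eq′))) det≡0) (zeros p q))
      where
      zeros : ∀ p q → p * 0ℤ + q * 0ℤ ≡ 0ℤ
      zeros = solve-∀
    -- Multiplied by `a` or by `b`, `δ` becomes a combination of `det` and the difference of the two
    -- first-row values, both zero; `cancel` then uses whichever of `a`, `b` is nonzero.
    a-ring : a * δ ≡ c * ((x * a + y * b) - (x′ * a + y′ * b)) + (y - y′) * det
    a-ring = ring x y x′ y′ a b c d
      where
      ring : ∀ x y x′ y′ a b c d → a * ((x * c + y * d) - (x′ * c + y′ * d)) ≡
        c * ((x * a + y * b) - (x′ * a + y′ * b)) + (y - y′) * (a * d - b * c)
      ring = solve-∀
    b-ring : b * δ ≡ d * ((x * a + y * b) - (x′ * a + y′ * b)) + (x′ - x) * det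
    b-ring = ring x y x′ y′ a b c d
      where
      ring : ∀ x y x′ y′ a b c d → b * ((x * c + y * d) - (x′ * c + y′ * d)) ≡
        d * ((x * a + y * b) - (x′ * a + y′ * b)) + (x′ - x) * (a * d - b * c)
      ring = solve-∀
    cancel : a * δ ≡ 0ℤ → b * δ ≡ 0ℤ → δ ≡ 0ℤ
    cancel aδ≡0 bδ≡0 with i*j≡0⇒i≡0∨j≡0 a aδ≡0 | i*j≡0⇒i≡0∨j≡0 b bδ≡0
    ... | inj₂ δ≡0 | _        = δ≡0
    ... | _        | inj₂ δ≡0 = δ≡0
    ... | inj₁ a≡0 | inj₁ b≡0 = contradiction (a≡0 , b≡0) row₁≢0

  private
    zero-row : ∀ x y → x * 0ℤ + y * 0ℤ ≡ 0ℤ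
    zero-row = solve-∀

  singular? : ∀ e f → det ≡ 0ℤ → Dec (∃₂ (System e f))
  singular? e f det≡0 with (a ≟ 0ℤ) ×-dec (b ≟ 0ℤ)
  -- With a zero first row, the first equation is a condition on `e` alone.
  ... | yes (refl , refl) = map′
    (λ { (refl , x , y , eq) → x , y , zero-row x y , eq })
    (λ { (x , y , eq , eq′) → trans (sym eq) (zero-row x y) , x , y , eq′ })
    ((e ≟ 0ℤ) ×-dec linear? c d f)
  ... | no row₁≢0 with linear? a b e
  ...   | no unsolvable = no λ { (x , y , eq , _) → unsolvable (x , y , eq) }
  ...   | yes (x , y , eq) = map′
    (λ eq′ → x , y , eq , eq′)
    (λ { (x′ , y′ , sol) → row₂-determined x y x′ y′ det≡0 row₁≢0 (eq , refl) sol })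
    (x * c + y * d ≟ f)

  system? : ∀ e f → Dec (∃₂ (System e f))
  system? e f with det ≟ 0ℤ
  ... | yes det≡0 = singular? e f det≡0
  ... | no  det≢0 = regular? e f det≢0

  kernel-trivial : ∀ {x y} → det ≢ 0ℤ → System 0ℤ 0ℤ x y → x ≡ 0ℤ × y ≡ 0ℤ
  kernel-trivial {x} {y} det≢0 (eq , eq′) =
    cancel (trans (cramer-x x y a b c d) (trans (cong₂ (λ m n → m * d - n * b) eq eq′) (zeros d b))) ,
    cancel (trans (cramer-y x y a b c d) (trans (cong₂ (λ m n → n * a - m * c) eq eq′) (zeros a c)))
    where
    zeros : ∀ i j → 0ℤ * i - 0ℤ * j ≡ 0ℤ
    zeros = solve-∀
    cancel : ∀ {i} → i * det ≡ 0ℤ → i ≡ 0ℤ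
    cancel {i} p = [ (λ i≡0 → i≡0) , (λ det≡0 → contradiction det≡0 det≢0) ]′ (i*j≡0⇒i≡0∨j≡0 i p)

  private
    double-neg : ∀ i → i ≡ - - i
    double-neg = solve-∀
    swap : ∀ i j → j * i + (- i) * j ≡ 0ℤ
    swap = solve-∀

  -- A row turned by a right angle is orthogonal to itself, and orthogonal to the other row because
  -- the determinant vanishes. It is nonzero if the row is; if both rows are zero, any nonzero
  -- vector will do.
  kernel-nontrivial : det ≡ 0ℤ → ∃₂ λ x y → NonTrivial x y × System 0ℤ 0ℤ x y
  kernel-nontrivial det≡0 with (a ≟ 0ℤ) ×-dec (b ≟ 0ℤ) | (c ≟ 0ℤ) ×-dec (d ≟ 0ℤ)
  ... | no row₁≢0 | _ = b , - a ,
    (λ { (b≡0 , -a≡0) → row₁≢0 (trans (double-neg a) (cong -_ -a≡0) , b≡0) }) ,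
    swap a b , trans (minor a b c d) (cong -_ det≡0)
    where
    minor : ∀ a b c d → b * c + (- a) * d ≡ - (a * d - b * c)
    minor = solve-∀
  ... | yes _ | no row₂≢0 = d , - c ,
    (λ { (d≡0 , -c≡0) → row₂≢0 (trans (double-neg c) (cong -_ -c≡0) , d≡0) }) ,
    trans (minor a b c d) det≡0 , swap c d
    where
    minor : ∀ a b c d → d * a + (- c) * b ≡ a * d - b * c
    minor = solve-∀
  ... | yes (refl , refl) | yes (refl , refl) = 1ℤ , 0ℤ , (λ { (() , _) }) , refl , refl

  -- The zero vector solves only the homogeneous system, so nontriviality needs attention just
  -- there, where the determinant settles it.
  nontrivial? : ∀ e f → Dec (∃₂ λ x y → NonTrivial x y × System e f x y)
  nontrivial? e f with (e ≟ 0ℤ) ×-dec (f ≟ 0ℤ) | det ≟ 0ℤ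
  ... | yes (refl , refl) | yes det≡0 = yes (kernel-nontrivial det≡0)
  ... | yes (refl , refl) | no  det≢0 =
    no λ { (_ , _ , ≢0 , sol) → ≢0 (kernel-trivial det≢0 sol) }
  ... | no ef≢0 | _ = map′
    (λ { (x , y , sol) → x , y , (λ { (refl , refl) → ef≢0 (zero-solution sol) }) , sol })
    (λ { (x , y , _ , sol) → x , y , sol })
    (system? e f)
    where
    zero-solution : System e f 0ℤ 0ℤ → e ≡ 0ℤ × f ≡ 0ℤ
    zero-solution (eq , eq′) = sym eq , sym eq′

-- Lists, walks and self-avoiding paths

module _ {a} {A : Set a} where

  -- Set equality ignores multiplicity, so `c` and `c′` may be matched with the same element; the
  -- converse inclusion then makes all four coincide.
  pair-∼⇒≡ : {c c′ p q : A} → (c ∷ c′ ∷ []) ∼[ set ] (p ∷ q ∷ []) →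
    (c ≡ p × c′ ≡ q) ⊎ (c ≡ q × c′ ≡ p)
  pair-∼⇒≡ eq with Equivalence.to eq (here refl) | Equivalence.to eq (there (here refl))
  ... | here c≡p         | there (here c′≡q) = inj₁ (c≡p , c′≡q)
  ... | there (here c≡q) | here c′≡p         = inj₂ (c≡q , c′≡p)
  ... | here refl        | here refl with Equivalence.from eq (there (here refl))
  ...   | here refl         = inj₁ (refl , refl)
  ...   | there (here refl) = inj₁ (refl , refl)
  pair-∼⇒≡ eq | there (here refl) | there (here refl) with Equivalence.from eq (here refl)
  ...   | here refl         = inj₁ (refl , refl)
  ...   | there (here refl) = inj₁ (refl , refl)

  <∣>-justˡ : ∀ {m n : Maybe A} → (∃[ x ] m ≡ just x) → ∃[ x ] (m <∣> n) ≡ just x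
  <∣>-justˡ (x , refl) = x , refl

  <∣>-justʳ : ∀ (m : Maybe A) {n} → (∃[ x ] n ≡ just x) → ∃[ x ] (m <∣> n) ≡ just x
  <∣>-justʳ (just x) _          = x , refl
  <∣>-justʳ nothing  (x , refl) = x , refl

  head-just : ∀ {x : A} {xs} → x ∈ xs → ∃[ y ] head xs ≡ just y
  head-just {xs = y ∷ _} _ = y , refl

  last∈ : ∀ {y : A} xs → last xs ≡ just y → y ∈ xs
  last∈ (x ∷ [])     refl = here refl
  last∈ (_ ∷ x ∷ xs) eq   = there (last∈ (x ∷ xs) eq)

  unique-map⇒injective : ∀ {b} {B : Set b} (f : A → B) {xs x y} → Unique (map f xs) →
    x ∈ xs → y ∈ xs → f x ≡ f y → x ≡ y
  unique-map⇒injective f _        (here refl) (here refl) _  = refl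
  unique-map⇒injective f (f≢ ∷ _)  (here refl) (there y∈)  eq =
    contradiction eq (All.lookup f≢ (∈-map⁺ f y∈))
  unique-map⇒injective f (f≢ ∷ _)  (there x∈)  (here refl) eq =
    contradiction (sym eq) (All.lookup f≢ (∈-map⁺ f x∈))
  unique-map⇒injective f (_ ∷ u)  (there x∈)  (there y∈)  eq =
    unique-map⇒injective f u x∈ y∈ eq

module _ {a r} {A : Set a} {R : A → A → Set r} where

  intermediate : ∀ {x y} → Star R x y → List A
  intermediate ε                = []
  intermediate (_◅_ {j = z} _ s) = z ∷ intermediate s

  vertices : ∀ {x y} → Star R x y → List A
  vertices {x} s = x ∷ intermediate s

  last-vertices : ∀ {x y} (s : Star R x y) → last (vertices s) ≡ just y
  last-vertices ε       = refl
  last-vertices (_ ◅ s) = last-vertices s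

  linked-vertices : ∀ {x y} (s : Star R x y) → Linked R (vertices s)
  linked-vertices ε       = [-]
  linked-vertices (r ◅ s) = r ∷ linked-vertices s

  All-vertices : ∀ {p} {P : A → Set p} → (∀ {x y} → R x y → P y) →
    ∀ {x y} → P x → (s : Star R x y) → ∀ {z} → z ∈ vertices s → P z
  All-vertices R⇒P px s       (here refl) = px
  All-vertices R⇒P px (r ◅ s) (there z∈)  = All-vertices R⇒P (R⇒P r) s z∈

  -- Both ends are recorded so that a walk extracted from a list can be shown to stay among its
  -- members.
  Within : List A → A → A → Set _
  Within xs x y = x ∈ xs × y ∈ xs × R x y

  linked⇒star : ∀ {x xs y} → Linked R (x ∷ xs) → y ∈ x ∷ xs → Star (Within (x ∷ xs)) x y
  linked⇒star _        (here refl) = ε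
  linked⇒star (r ∷ rs) (there y∈)  =
    (here refl , there (here refl) , r) ◅
    gmap id (λ { (u∈ , v∈ , r′) → there u∈ , there v∈ , r′ }) (linked⇒star rs y∈)

  -- Walk from `x` back to the head of the list, then forward to `y`.
  linked⇒connected : (∀ {x y} → R x y → R y x) → ∀ {xs x y} → Linked R xs →
    x ∈ xs → y ∈ xs → Star (Within xs) x y
  linked⇒connected R-sym {xs = _ ∷ _} rs x∈ y∈ =
    reverse (λ { (u∈ , v∈ , r) → v∈ , u∈ , R-sym r }) (linked⇒star rs x∈) ◅◅ linked⇒star rs y∈

-- Unit steps and norm-decreasing walks in the plane

e₁ e₂ : ℤ^ 2
e₁ = 1ℤ ∷ 0ℤ ∷ []
e₂ = 0ℤ ∷ 1ℤ ∷ []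

neg-unitStep : ∀ {u} → IsUnitStep u → IsUnitStep (neg u)
neg-unitStep (here refl)                         = there (here refl)
neg-unitStep (there (here refl))                 = here refl
neg-unitStep (there (there (here refl)))         = there (there (there (here refl)))
neg-unitStep (there (there (there (here refl)))) = there (there (here refl))

neg-sub : ∀ (u v : ℤ^ 2) → neg (u -ᵥ v) ≡ v -ᵥ u
neg-sub (x ∷ y ∷ []) (x′ ∷ y′ ∷ []) = cong₂ (λ i j → i ∷ j ∷ []) (ring x x′) (ring y y′)
  where
  ring : ∀ i j → - (i + - j) ≡ j + - i
  ring = solve-∀

shift-sub : ∀ (w u v : ℤ^ 2) → (w +ᵥ u) -ᵥ (w +ᵥ v) ≡ u -ᵥ v
shift-sub (i ∷ j ∷ []) (x ∷ y ∷ []) (x′ ∷ y′ ∷ []) =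
  cong₂ (λ i j → i ∷ j ∷ []) (ring i x x′) (ring j y y′)
  where
  ring : ∀ w i j → (w + i) + - (w + j) ≡ i + - j
  ring = solve-∀

sub-0 : ∀ (u : ℤ^ 2) → u -ᵥ 0ᵥ ≡ u
sub-0 (x ∷ y ∷ []) = cong₂ (λ i j → i ∷ j ∷ []) (ring x) (ring y)
  where
  ring : ∀ i → i + - 0ℤ ≡ i
  ring = solve-∀

unit-sym : ∀ (u v : ℤ^ 2) → IsUnitStep (u -ᵥ v) → IsUnitStep (v -ᵥ u)
unit-sym u v = subst IsUnitStep (neg-sub u v) ∘ neg-unitStep

norm : ℤ^ 2 → ℕ
norm (x ∷ y ∷ []) = ∣ x ∣ ℕ.+ ∣ y ∣

decrease : ∀ i → i ≢ 0ℤ → ∃[ j ] (j + - i ≡ 1ℤ ⊎ j + - i ≡ -1ℤ) × ∣ j ∣ ℕ.< ∣ i ∣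
decrease (+ zero)  i≢0 = contradiction refl i≢0
decrease (+ suc n) _   = + n , inj₂ (ring (+ n)) , ℕ.≤-refl
  where
  ring : ∀ i → i + - (1ℤ + i) ≡ -1ℤ
  ring = solve-∀
decrease -[1+ n ]  _   = - (+ n) , inj₁ (ring (+ n)) , ℕ.s≤s (ℕ.≤-reflexive (∣-i∣≡∣i∣ (+ n)))
  where
  ring : ∀ i → - i + - (- (1ℤ + i)) ≡ 1ℤ
  ring = solve-∀

-- Paths made of these steps are self-avoiding, since the norm decreases along them.
_⟶_ : ℤ^ 2 → ℤ^ 2 → Set
u ⟶ v = IsUnitStep (v -ᵥ u) × norm v ℕ.< norm u

-- The first coordinate is reduced until it vanishes, and only then the second.
approach : ∀ x y → NonTrivial x y → ∃[ v ] (x ∷ y ∷ []) ⟶ v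
approach x y ≢0 with x ≟ 0ℤ
... | no x≢0 with decrease x x≢0
...   | j , inj₁ eq , lt = (j ∷ y ∷ []) ,
  here (cong₂ (λ i j → i ∷ j ∷ []) eq (i≡j⇒i-j≡0 {y} refl)) , ℕ.+-monoˡ-< ∣ y ∣ lt
...   | j , inj₂ eq , lt = (j ∷ y ∷ []) ,
  there (here (cong₂ (λ i j → i ∷ j ∷ []) eq (i≡j⇒i-j≡0 {y} refl))) , ℕ.+-monoˡ-< ∣ y ∣ lt
approach x y ≢0 | yes refl with decrease y (λ y≡0 → ≢0 (refl , y≡0))
...   | j , inj₁ eq , lt = (0ℤ ∷ j ∷ []) , there (there (here (cong (λ i → 0ℤ ∷ i ∷ []) eq))) , lt
...   | j , inj₂ eq , lt = (0ℤ ∷ j ∷ []) , there (there (there (here (cong (λ i → 0ℤ ∷ i ∷ []) eq)))) , lt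

module _ {k : ℕ} where

  _⟶ᶜ_ : Cell 2 k → Cell 2 k → Set
  _⟶ᶜ_ = _⟶_ on vector

  to-origin : ∀ t v → Acc ℕ._<_ (norm v) → Star _⟶ᶜ_ [ v , t ] [ 0ᵥ , t ]
  to-origin t (x ∷ y ∷ []) (acc rec)
    with x ≟ 0ℤ | y ≟ 0ℤ
  ... | yes refl | yes refl = ε
  ... | no x≢0   | _ with v , st ← approach x y (x≢0 ∘ proj₁) = st ◅ to-origin t v (rec (proj₂ st))
  ... | yes _    | no y≢0 with v , st ← approach x y (y≢0 ∘ proj₂) = st ◅ to-origin t v (rec (proj₂ st))

  -- The steps ignore types, so the type may change at the first step and stay `t′` from then on.
  -- Nontriviality guarantees that there is a first step.
  descent : ∀ x y t t′ → NonTrivial x y → Star _⟶ᶜ_ [ x ∷ y ∷ [] , t ] [ 0ᵥ , t′ ]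
  descent x y t t′ ≢0 with v , st ← approach x y ≢0 = st ◅ to-origin t′ v (<-wellFounded _)

  descending⇒distinct : ∀ {γ : CellSet 2 k} → Linked _⟶ᶜ_ γ → Unique (supp γ)
  descending⇒distinct lnk = AllPairs.map⁺ (AllPairs.map (λ lt eq → ℕ.<-irrefl (cong norm (sym eq)) lt)
    (Linked⇒AllPairs {R = λ c c′ → norm (vector c′) ℕ.< norm (vector c)}
      (λ p q → ℕ.<-trans q p) (Linked.map proj₂ lnk)))

unit⇒≢ : ∀ {u v : ℤ^ 2} → IsUnitStep (v -ᵥ u) → u ≢ v
unit⇒≢ {x ∷ y ∷ []} unit refl = 0-not-unit (subst IsUnitStep
  (cong₂ (λ i j → i ∷ j ∷ []) (i≡j⇒i-j≡0 {x} refl) (i≡j⇒i-j≡0 {y} refl)) unit)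
  where
  0-not-unit : ¬ IsUnitStep 0ᵥ
  0-not-unit (there (there (there (there ()))))

-- Substitutions

module _ {k : ℕ} (σ : Substitution 2 k) where
  open Substitution σ

  lookupRule-defined : ∀ {r l} → r ∈ rules → proj₁ r ≡ l → ∃[ v ] lookupRule σ l ≡ just v
  lookupRule-defined {l = l} r∈ eq
    with (_ , v) , head≡ ← head-just (∈-filter⁺ (λ r → proj₁ r ≟ₗ l) r∈ eq) =
    v , cong (Maybe.map proj₂) head≡

  -- Adjacency fixes only the unordered pair. If the rule is found in the opposite order, the second
  -- alternative of `σ-rule` gives a value, unless the first already has.
  σ-rule-defined : ∀ {c c′} → Adjacent σ c c′ → ∃[ v ] σ-rule σ c c′ ≡ just v
  σ-rule-defined (_ , S∈ , w , eq) with ∈-map⁻ startingPattern S∈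
  ... | ((t , t′ , u) , _) , r∈ , refl
      with pair-∼⇒≡ eq | lookupRule-defined r∈ (cong (λ x → t , t′ , x)
             (sym (trans (shift-sub w u 0ᵥ) (sub-0 u))))
  ...   | inj₁ (refl , refl) | found    = <∣>-justˡ found
  ...   | inj₂ (refl , refl) | v , eq′ =
    <∣>-justʳ (lookupRule σ (t′ , t , _)) (neg v , cong (Maybe.map neg) eq′)

  σ-rule-translation : ∀ {t t′} u u′ v v′ → u′ -ᵥ u ≡ v′ -ᵥ v →
    σ-rule σ [ u , t ] [ u′ , t′ ] ≡ σ-rule σ [ v , t ] [ v′ , t′ ]
  σ-rule-translation {t} {t′} u u′ v v′ eq =
    cong₂ (λ p q → lookupRule σ (t , t′ , p) <∣> Maybe.map neg (lookupRule σ (t′ , t , q)))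
      eq (trans (sym (neg-sub u′ u)) (trans (cong neg eq) (neg-sub v′ v)))

  -- Compatibility is automatic inside a pattern, whose cells have pairwise distinct vectors.
  isPathOf : ∀ P {γ c c′} → head γ ≡ just c → last γ ≡ just c′ →
    Linked (Adjacent σ) γ → γ ⊆ cells P → IsPathOf σ P c c′ γ
  isPathOf P hd lst lnk γ⊆P = record
    { starts     = hd
    ; ends       = lst
    ; linked     = lnk
    ; compatible = λ x∈ y∈ → unique-map⇒injective vector (distinct P) (γ⊆P x∈) (γ⊆P y∈)
    } , γ⊆P

  module Domino (complete : DominoComplete σ) where

    -- The starting pattern is an unordered pair both as a translate of `c`, `c′` and as a domino;
    -- hence the four cases, up to the sign of the step.
    adjacent⇒unit : ∀ {c c′} → Adjacent σ c c′ → IsUnitStep (vector c′ -ᵥ vector c)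
    adjacent⇒unit (_ , S∈ , w , eq) with ∈-map⁻ startingPattern S∈ | proj₁ complete S∈
    ... | ((t , t′ , u) , _) , _ , refl | d , d′ , eq′ , unit with pair-∼⇒≡ eq | pair-∼⇒≡ eq′
    ...   | inj₁ (refl , refl) | inj₁ (refl , refl) =
      subst IsUnitStep (sym (shift-sub w u 0ᵥ)) unit
    ...   | inj₁ (refl , refl) | inj₂ (refl , refl) =
      subst IsUnitStep (sym (shift-sub w u 0ᵥ)) (unit-sym 0ᵥ u unit)
    ...   | inj₂ (refl , refl) | inj₁ (refl , refl) =
      subst IsUnitStep (sym (shift-sub w 0ᵥ u)) (unit-sym u 0ᵥ unit)
    ...   | inj₂ (refl , refl) | inj₂ (refl , refl) =
      subst IsUnitStep (sym (shift-sub w 0ᵥ u)) unit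

    unit⇒adjacent : ∀ {c c′} → IsUnitStep (vector c′ -ᵥ vector c) → Adjacent σ c c′
    unit⇒adjacent {c} {c′} unit = proj₂ complete (c , c′ , mk⇔ id id , unit)

    adjacent-sym : ∀ {c c′} → Adjacent σ c c′ → Adjacent σ c′ c
    adjacent-sym {c} {c′} adj =
      unit⇒adjacent (unit-sym (vector c′) (vector c) (adjacent⇒unit adj))

    -- This reduces coveredness to listing the cells of a pattern in the order of a walk, since
    -- dominoes can be crossed both ways.
    linked⇒covered : ∀ P → Linked (Adjacent σ) (cells P) → Covered σ P
    linked⇒covered P lnk {c} {c′} c∈ c′∈ = vertices s ,
      isPathOf P refl (last-vertices s) (Linked.map (proj₂ ∘ proj₂) (linked-vertices s))
        (All-vertices (proj₁ ∘ proj₂) c∈ s)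
      where
      s : Star (Within (cells P)) c c′
      s = linked⇒connected adjacent-sym lnk c∈ c′∈

-- Commutation of the squares forces h and v to be, up to constants, the
-- differences of one function q.
module Potential {a} {A : Set a} (o : A) (h v : A → A → ℤ)
  (square : ∀ a b c d → h a b + v b d ≡ v a c + h c d) where

  q : A → ℤ
  q a = v o a - v o o

  -- One coordinate of the image of a cell: `h o o` and `v o o` form a row of the matrix, and `q` is
  -- the offset due to the type.
  position : ℤ^ 2 → A → ℤ
  position (x ∷ y ∷ []) a = x * h o o + y * v o o + q a

  displace : ℤ → ℤ → A → A → ℤ
  displace x y a b = x * h o o + y * v o o + (q b - q a)

  private
    square-0 : ∀ a b c d → (h a b + v b d) - (v a c + h c d) ≡ 0ℤ
    square-0 a b c d = i≡j⇒i-j≡0 (square a b c d)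

    -- Adding the squares `o a o o` and `o o o a` cancels all horizontal terms.
    symmetric : ∀ a → (v a o + v o a) - (v o o + v o o) ≡ 0ℤ
    symmetric a = trans (ring (h o a) (h o o) (v a o) (v o a) (v o o))
      (cong₂ _+_ (square-0 o a o o) (square-0 o o o a))
      where
      ring : ∀ hoa hoo vao voa voo → (vao + voa) - (voo + voo) ≡
        ((hoa + vao) - (voo + hoo)) + ((hoo + voa) - (voo + hoa))
      ring = solve-∀

  -- The square with bottom row `a b` and top row `o o` expresses `h a b` by `v a o` and `v b o`;
  -- `symmetric` turns these into `v o a` and `v o b`.
  horizontal : ∀ a b → h a b ≡ displace 1ℤ 0ℤ a b
  horizontal a b = i-j≡0⇒i≡j _ _ (trans
    (ring (h a b) (h o o) (v o o) (v o a) (v o b) (v a o) (v b o))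
    (cong₂ _+_ (cong₂ _-_ (square-0 a b o o) (symmetric b)) (symmetric a)))
    where
    ring : ∀ hab hoo voo voa vob vao vbo →
      hab - (1ℤ * hoo + 0ℤ * voo + ((vob - voo) - (voa - voo))) ≡
      ((hab + vbo) - (vao + hoo)) - ((vbo + vob) - (voo + voo)) + ((vao + voa) - (voo + voo))
    ring = solve-∀

  -- Squares with right column `o o` express `v a b` by `h a o` and `h b o`, and these in turn by
  -- `v o a` and `v o b`.
  vertical : ∀ a b → v a b ≡ displace 0ℤ 1ℤ a b
  vertical a b = i-j≡0⇒i≡j _ _ (trans
    (ring (v a b) (h o o) (v o o) (v o a) (v o b) (h a o) (h b o))
    (cong₂ _-_ (cong₂ _-_ (square-0 o o b o) (square-0 a o b o)) (square-0 o o a o)))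
    where
    ring : ∀ vab hoo voo voa vob hao hbo →
      vab - (0ℤ * hoo + 1ℤ * voo + ((vob - voo) - (voa - voo))) ≡
      ((hoo + voo) - (vob + hbo)) - ((hao + voo) - (vab + hbo)) - ((hoo + voo) - (voa + hao))
    ring = solve-∀

  position-diff : ∀ x y x′ y′ a b →
    position (x′ ∷ y′ ∷ []) b - position (x ∷ y ∷ []) a ≡ displace (x′ - x) (y′ - y) a b
  position-diff x y x′ y′ a b = ring x y x′ y′ (h o o) (v o o) (q a) (q b)
    where
    ring : ∀ x y x′ y′ h v qa qb → (x′ * h + y′ * v + qb) - (x * h + y * v + qa) ≡
      (x′ - x) * h + (y′ - y) * v + (qb - qa)
    ring = solve-∀

sum-0⇒neg : ∀ {u v : ℤ^ 2} → u +ᵥ (v +ᵥ 0ᵥ) ≡ 0ᵥ → u ≡ neg v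
sum-0⇒neg {x ∷ y ∷ []} {x′ ∷ y′ ∷ []} eq = cong₂ (λ i j → i ∷ j ∷ [])
  (component x x′ (∷-injectiveˡ eq)) (component y y′ (∷-injectiveˡ (∷-injectiveʳ eq)))
  where
  component : ∀ i j → i + (j + 0ℤ) ≡ 0ℤ → i ≡ - j
  component i j eq = i-j≡0⇒i≡j _ _ (trans (ring i j) eq)
    where
    ring : ∀ i j → i - - j ≡ i + (j + 0ℤ)
    ring = solve-∀

telescope : ∀ (u v w : ℤ^ 2) → (v -ᵥ u) +ᵥ (w -ᵥ v) ≡ w -ᵥ u
telescope (x ∷ y ∷ []) (x′ ∷ y′ ∷ []) (x″ ∷ y″ ∷ []) =
  cong₂ (λ i j → i ∷ j ∷ []) (ring x x′ x″) (ring y y′ y″)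
  where
  ring : ∀ i j k → (j + - i) + (k + - j) ≡ k + - i
  ring = solve-∀

-ᵥ-self : ∀ (u : ℤ^ 2) → u -ᵥ u ≡ 0ᵥ
-ᵥ-self (x ∷ y ∷ []) = cong₂ (λ i j → i ∷ j ∷ []) (i≡j⇒i-j≡0 {x} refl) (i≡j⇒i-j≡0 {y} refl)

module _ {d k : ℕ} {S : CellSet d k} where

  translate⁺ : ∀ w {v} → v ∈ supp S → w +ᵥ v ∈ supp (translate w S)
  translate⁺ w v∈ with c , c∈ , refl ← ∈-map⁻ vector v∈ = ∈-map⁺ vector (∈-map⁺ _ c∈)

  translate⁻ : ∀ w {v} → v ∈ supp (translate w S) → ∃[ v′ ] v′ ∈ supp S × v ≡ w +ᵥ v′
  translate⁻ w v∈ with _ , c∈ , refl ← ∈-map⁻ vector v∈ with c , c∈′ , refl ← ∈-map⁻ _ c∈ =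
    vector c , ∈-map⁺ vector c∈′ , refl

-- Constraints that consistency puts on the rules

module Consistency {k : ℕ} (σ : Substitution 2 k)
  (consistent : Consistent σ) (complete : DominoComplete σ) where
  open Substitution σ
  open Domino σ complete

  dominoPattern : ∀ c c′ → Adjacent σ c c′ → Pattern 2 k
  dominoPattern c c′ adj = record
    { cells    = c ∷ c′ ∷ []
    ; distinct = (unit⇒≢ (adjacent⇒unit adj) ∷ []) ∷ [] ∷ []
    }

  -- Going to `c′` and back is a path, because a path may revisit the same cell; consistency
  -- compares it with the path that stays at `c`.
  σ-rule-antisym : ∀ {c c′ w} → Adjacent σ c c′ →
    σ-rule σ c′ c ≡ just w → σ-rule σ c c′ ≡ just (neg w)
  σ-rule-antisym {c} {c′} {w} adj back with v , forth ← σ-rule-defined σ adj =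
    trans forth (cong just (sum-0⇒neg (just-injective (trans (sym ω-loop) loop-trivial))))
    where
    P : Pattern 2 k
    P = dominoPattern c c′ adj
    loop : IsPathOf σ P c c (c ∷ c′ ∷ c ∷ [])
    loop = isPathOf σ P refl refl (adj ∷ adjacent-sym adj ∷ [-])
      (λ { (here p) → here p ; (there (here p)) → there (here p) ; (there (there (here p))) → here p })
    stay : IsPathOf σ P c c (c ∷ [])
    stay = isPathOf σ P refl refl [-] (λ { (here p) → here p })
    loop-trivial : ω σ (c ∷ c′ ∷ c ∷ []) ≡ just 0ᵥ
    loop-trivial = consistent P (linked⇒covered P (adj ∷ [-])) (here refl) (here refl) loop stay
    ω-loop : ω σ (c ∷ c′ ∷ c ∷ []) ≡ just (v +ᵥ (w +ᵥ 0ᵥ))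
    ω-loop = cong₂ (λ m n → Maybe.zipWith _+ᵥ_ m (Maybe.zipWith _+ᵥ_ n (just 0ᵥ))) forth back

  along : ∀ u → IsUnitStep u → (t t′ : Fin k) →
    ∃₂ λ x y → σ-rule σ [ 0ᵥ , t ] [ u , t′ ] ≡ just (x ∷ y ∷ [])
  along u unit t t′
    with (x ∷ y ∷ []) , eq ← σ-rule-defined σ {[ 0ᵥ , t ]} {[ u , t′ ]}
      (unit⇒adjacent (subst IsUnitStep (sym (sub-0 u)) unit)) = x , y , eq

  e₁-unit : IsUnitStep e₁
  e₁-unit = here refl

  e₂-unit : IsUnitStep e₂
  e₂-unit = there (there (here refl))

  h₁ h₂ v₁ v₂ : Fin k → Fin k → ℤ
  h₁ t t′ = proj₁ (along e₁ e₁-unit t t′)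
  h₂ t t′ = proj₁ (proj₂ (along e₁ e₁-unit t t′))
  v₁ t t′ = proj₁ (along e₂ e₂-unit t t′)
  v₂ t t′ = proj₁ (proj₂ (along e₂ e₂-unit t t′))

  σ-rule-h : ∀ {t t′} u u′ → u′ -ᵥ u ≡ e₁ →
    σ-rule σ [ u , t ] [ u′ , t′ ] ≡ just (h₁ t t′ ∷ h₂ t t′ ∷ [])
  σ-rule-h {t} {t′} u u′ eq = trans (σ-rule-translation σ u u′ 0ᵥ e₁ eq)
    (proj₂ (proj₂ (along e₁ e₁-unit t t′)))

  σ-rule-v : ∀ {t t′} u u′ → u′ -ᵥ u ≡ e₂ →
    σ-rule σ [ u , t ] [ u′ , t′ ] ≡ just (v₁ t t′ ∷ v₂ t t′ ∷ [])
  σ-rule-v {t} {t′} u u′ eq = trans (σ-rule-translation σ u u′ 0ᵥ e₂ eq)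
    (proj₂ (proj₂ (along e₂ e₂-unit t t′)))

  -- The cells are listed around the square, with `d` before `c`, so that consecutive ones are
  -- adjacent and `linked⇒covered` applies.
  squarePattern : Fin k → Fin k → Fin k → Fin k → Pattern 2 k
  squarePattern a b c d = record
    { cells    = [ 0ᵥ , a ] ∷ [ e₁ , b ] ∷ [ e₁ +ᵥ e₂ , d ] ∷ [ e₂ , c ] ∷ []
    ; distinct = ((λ ()) ∷ (λ ()) ∷ (λ ()) ∷ []) ∷ ((λ ()) ∷ (λ ()) ∷ []) ∷ ((λ ()) ∷ []) ∷ [] ∷ []
    }

  -- Consistency is applied to the two paths from the lower left to the upper right corner.
  square : ∀ a b c d →
    (h₁ a b + v₁ b d ∷ h₂ a b + v₂ b d ∷ []) ≡ (v₁ a c + h₁ c d ∷ v₂ a c + h₂ c d ∷ [])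
  square a b c d = just-injective (trans (sym lower-ω) (trans (consistent P
    (linked⇒covered P (unit⇒adjacent e₁-unit ∷ unit⇒adjacent e₂-unit ∷
      unit⇒adjacent (there (here refl)) ∷ [-]))
    (here refl) (there (there (here refl))) lower upper) upper-ω))
    where
    P : Pattern 2 k
    P = squarePattern a b c d
    α β γ δ : Cell 2 k
    α = [ 0ᵥ , a ]
    β = [ e₁ , b ]
    γ = [ e₂ , c ]
    δ = [ e₁ +ᵥ e₂ , d ]
    lower : IsPathOf σ P α δ (α ∷ β ∷ δ ∷ [])
    lower = isPathOf σ P refl refl (unit⇒adjacent e₁-unit ∷ unit⇒adjacent e₂-unit ∷ [-])
      (λ { (here p) → here p ; (there (here p)) → there (here p)
         ; (there (there (here p))) → there (there (here p)) })
    upper : IsPathOf σ P α δ (α ∷ γ ∷ δ ∷ [])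
    upper = isPathOf σ P refl refl (unit⇒adjacent e₂-unit ∷ unit⇒adjacent e₁-unit ∷ [-])
      (λ { (here p) → here p ; (there (here p)) → there (there (there (here p)))
         ; (there (there (here p))) → there (there (here p)) })
    two-steps : ∀ {c₁ c₂ c₃ x y x′ y′} → σ-rule σ c₁ c₂ ≡ just (x ∷ y ∷ []) →
      σ-rule σ c₂ c₃ ≡ just (x′ ∷ y′ ∷ []) →
      ω σ (c₁ ∷ c₂ ∷ c₃ ∷ []) ≡ just (x + x′ ∷ y + y′ ∷ [])
    two-steps {x = x} {y} {x′} {y′} eq eq′ = trans
      (cong₂ (λ m n → Maybe.zipWith _+ᵥ_ m (Maybe.zipWith _+ᵥ_ n (just 0ᵥ))) eq eq′)
      (cong₂ (λ i j → just (x + i ∷ y + j ∷ [])) (+-identityʳ x′) (+-identityʳ y′))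
    lower-ω : ω σ (α ∷ β ∷ δ ∷ []) ≡ just (h₁ a b + v₁ b d ∷ h₂ a b + v₂ b d ∷ [])
    lower-ω = two-steps {α} {β} {δ} (σ-rule-h 0ᵥ e₁ refl) (σ-rule-v e₁ (e₁ +ᵥ e₂) refl)
    upper-ω : ω σ (α ∷ γ ∷ δ ∷ []) ≡ just (v₁ a c + h₁ c d ∷ v₂ a c + h₂ c d ∷ [])
    upper-ω = two-steps {α} {γ} {δ} (σ-rule-v 0ᵥ e₂ refl) (σ-rule-h e₂ (e₁ +ᵥ e₂) refl)

  -- Image vectors as differences of positions

  module Position (o : Fin k) where

    module X = Potential o h₁ v₁ (λ a b c d → ∷-injectiveˡ (square a b c d))
    module Y = Potential o h₂ v₂ (λ a b c d → ∷-injectiveˡ (∷-injectiveʳ (square a b c d)))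

    position : Cell 2 k → ℤ^ 2
    position [ u , t ] = X.position u t ∷ Y.position u t ∷ []

    position-sub : ∀ x y x′ y′ {i j} t t′ →
      (x′ ∷ y′ ∷ []) -ᵥ (x ∷ y ∷ []) ≡ i ∷ j ∷ [] →
      position [ x′ ∷ y′ ∷ [] , t′ ] -ᵥ position [ x ∷ y ∷ [] , t ] ≡
      X.displace i j t t′ ∷ Y.displace i j t t′ ∷ []
    position-sub x y x′ y′ t t′ refl =
      cong₂ (λ i j → i ∷ j ∷ []) (X.position-diff x y x′ y′ t t′) (Y.position-diff x y x′ y′ t t′)

    σ-rule-forward : ∀ {c c′} → vector c′ -ᵥ vector c ≡ e₁ ⊎ vector c′ -ᵥ vector c ≡ e₂ →
      σ-rule σ c c′ ≡ just (position c′ -ᵥ position c)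
    σ-rule-forward {[ u@(x ∷ y ∷ []) , t ]} {[ u′@(x′ ∷ y′ ∷ []) , t′ ]} (inj₁ eq) =
      trans (σ-rule-h u u′ eq) (cong just (trans
        (cong₂ (λ i j → i ∷ j ∷ []) (X.horizontal t t′) (Y.horizontal t t′))
        (sym (position-sub x y x′ y′ t t′ eq))))
    σ-rule-forward {[ u@(x ∷ y ∷ []) , t ]} {[ u′@(x′ ∷ y′ ∷ []) , t′ ]} (inj₂ eq) =
      trans (σ-rule-v u u′ eq) (cong just (trans
        (cong₂ (λ i j → i ∷ j ∷ []) (X.vertical t t′) (Y.vertical t t′))
        (sym (position-sub x y x′ y′ t t′ eq))))

    σ-rule-backward : ∀ {c c′} → Adjacent σ c c′ →
      vector c -ᵥ vector c′ ≡ e₁ ⊎ vector c -ᵥ vector c′ ≡ e₂ →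
      σ-rule σ c c′ ≡ just (position c′ -ᵥ position c)
    σ-rule-backward {c} {c′} adj forward = trans
      (σ-rule-antisym adj (σ-rule-forward {c′} {c} forward))
      (cong just (neg-sub (position c) (position c′)))

    -- The potentials cover steps to the right and upwards; the two opposite directions follow by
    -- antisymmetry.
    σ-rule-position : ∀ {c c′} → Adjacent σ c c′ →
      σ-rule σ c c′ ≡ just (position c′ -ᵥ position c)
    σ-rule-position {c} {c′} adj = by-direction (adjacent⇒unit adj)
      where
      reversed : ∀ {e} → vector c′ -ᵥ vector c ≡ neg e → vector c -ᵥ vector c′ ≡ neg (neg e)
      reversed eq = trans (sym (neg-sub (vector c′) (vector c))) (cong neg eq)
      by-direction : IsUnitStep (vector c′ -ᵥ vector c) →
        σ-rule σ c c′ ≡ just (position c′ -ᵥ position c)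
      by-direction (here eq)                         = σ-rule-forward (inj₁ eq)
      by-direction (there (here eq))                 = σ-rule-backward adj (inj₁ (reversed {e₁} eq))
      by-direction (there (there (here eq)))         = σ-rule-forward (inj₂ eq)
      by-direction (there (there (there (here eq)))) = σ-rule-backward adj (inj₂ (reversed {e₂} eq))

    -- The sum telescopes, so only the end cells matter.
    ω-position : ∀ {γ c c′} → Linked (Adjacent σ) γ → head γ ≡ just c → last γ ≡ just c′ →
      ω σ γ ≡ just (position c′ -ᵥ position c)
    ω-position {c ∷ []} [-] refl refl = cong just (sym (-ᵥ-self (position c)))
    ω-position {c ∷ c₁ ∷ _} {_} {c′} (adj ∷ lnk) refl lst = trans
      (cong₂ (Maybe.zipWith _+ᵥ_) (σ-rule-position adj) (ω-position lnk refl lst))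
      (cong just (telescope (position c) (position c₁) (position c′)))

    -- Overlaps as nontrivial solutions of linear systems

    Clash : Fin k → Fin k → ℤ^ 2 → ℤ^ 2 → Set
    Clash t t′ (a ∷ b ∷ []) (a′ ∷ b′ ∷ []) = ∃₂ λ x y → NonTrivial x y ×
      System (h₁ o o) (v₁ o o) (h₂ o o) (v₂ o o)
        ((a′ - a) + (X.q t′ - X.q t)) ((b′ - b) + (Y.q t′ - Y.q t)) x y

    clash? : ∀ t t′ p p′ → Dec (Clash t t′ p p′)
    clash? t t′ (a ∷ b ∷ []) (a′ ∷ b′ ∷ []) =
      nontrivial? (h₁ o o) (v₁ o o) (h₂ o o) (v₂ o o) _ _

    -- The images of [ u , t ] and [ u′ , t′ ] meet at p = w + p′ exactly when
    -- u - u′ solves the linear system of Clash t t′ p p′.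
    module _ (x y x′ y′ : ℤ) (t t′ : Fin k) (a b a′ b′ : ℤ) where

      private
        c c′ : Cell 2 k
        c  = [ x ∷ y ∷ [] , t ]
        c′ = [ x′ ∷ y′ ∷ [] , t′ ]

        Meet : Set
        Meet = a ∷ b ∷ [] ≡ (position c′ -ᵥ position c) +ᵥ (a′ ∷ b′ ∷ [])

        Solved : Set
        Solved = System (h₁ o o) (v₁ o o) (h₂ o o) (v₂ o o)
          ((a′ - a) + (X.q t′ - X.q t)) ((b′ - b) + (Y.q t′ - Y.q t)) (x - x′) (y - y′)

        ring : ∀ x y x′ y′ h v q q′ a a′ →
          ((x - x′) * h + (y - y′) * v) - ((a′ - a) + (q′ - q)) ≡
          a - (((x′ * h + y′ * v + q′) - (x * h + y * v + q)) + a′)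
        ring = solve-∀

      meet⇒solved : Meet → Solved
      meet⇒solved eq =
        i-j≡0⇒i≡j _ _ (trans (ring x y x′ y′ (h₁ o o) (v₁ o o) (X.q t) (X.q t′) a a′)
          (i≡j⇒i-j≡0 (∷-injectiveˡ eq))) ,
        i-j≡0⇒i≡j _ _ (trans (ring x y x′ y′ (h₂ o o) (v₂ o o) (Y.q t) (Y.q t′) b b′)
          (i≡j⇒i-j≡0 (∷-injectiveˡ (∷-injectiveʳ eq))))

      solved⇒meet : Solved → Meet
      solved⇒meet (eq , eq′) = cong₂ (λ i j → i ∷ j ∷ [])
        (i-j≡0⇒i≡j _ _ (trans (sym (ring x y x′ y′ (h₁ o o) (v₁ o o) (X.q t) (X.q t′) a a′))
          (i≡j⇒i-j≡0 eq)))
        (i-j≡0⇒i≡j _ _ (trans (sym (ring x y x′ y′ (h₂ o o) (v₂ o o) (Y.q t) (Y.q t′) b b′))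
          (i≡j⇒i-j≡0 eq′)))

    SuppClash : Fin k → Fin k → Set
    SuppClash t t′ = Any (λ p → Any (Clash t t′ p) (supp (cells (base t′)))) (supp (cells (base t)))

    suppClash? : ∀ t t′ → Dec (SuppClash t t′)
    suppClash? t t′ = any? (λ p → any? (clash? t t′ p) _) _

    -- A cell of type `t` is placed at the solution and one of type `t′` at the origin. The cells of
    -- a descending walk between them form a covered pattern on which the two images meet.
    suppClash⇒overlapping : ∀ {t t′} → SuppClash t t′ → Overlapping σ
    suppClash⇒overlapping {t} {t′} clash nonOverlapping
      with (a ∷ b ∷ []) , p∈ , clash′ ← find clash
      with (a′ ∷ b′ ∷ []) , p′∈ , x , y , ≢0 , sol ← find clash′ =
      nonOverlapping P (linked⇒covered P linked) (here refl) last∈γ c≢c′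
        (isPathOf σ P refl (last-vertices s) linked id)
        (ω-position linked refl (last-vertices s))
        (p∈ , subst (_∈ supp (translate w (cells (base t′)))) (sym meet) (translate⁺ {S = cells (base t′)} w p′∈))
      where
      c c′ : Cell 2 k
      c  = [ x ∷ y ∷ [] , t ]
      c′ = [ 0ᵥ , t′ ]
      w : ℤ^ 2
      w = position c′ -ᵥ position c
      s : Star _⟶ᶜ_ c c′
      s = descent x y t t′ ≢0
      linked : Linked (Adjacent σ) (vertices s)
      linked = Linked.map (unit⇒adjacent ∘ proj₁) (linked-vertices s)
      P : Pattern 2 k
      P = record { cells = vertices s ; distinct = descending⇒distinct (linked-vertices s) }
      last∈γ : c′ ∈ vertices s
      last∈γ = last∈ (vertices s) (last-vertices s)
      c≢c′ : c ≢ c′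
      c≢c′ refl = ≢0 (refl , refl)
      x-0 : ∀ i → i ≡ i - 0ℤ
      x-0 i = sym (+-identityʳ i)
      meet : a ∷ b ∷ [] ≡ (position c′ -ᵥ position c) +ᵥ (a′ ∷ b′ ∷ [])
      meet = solved⇒meet x y 0ℤ 0ℤ t t′ a b a′ b′
        (subst₂ (System (h₁ o o) (v₁ o o) (h₂ o o) (v₂ o o) _ _) (x-0 x) (x-0 y) sol)

    -- The solution is the difference of the two vectors; it is nontrivial because they are
    -- distinct.
    meet⇒suppClash : ∀ c c′ p p′ → vector c ≢ vector c′ →
      p ∈ supp (cells (base (type c))) → p′ ∈ supp (cells (base (type c′))) →
      p ≡ (position c′ -ᵥ position c) +ᵥ p′ → SuppClash (type c) (type c′)
    meet⇒suppClash [ x ∷ y ∷ [] , t ] [ x′ ∷ y′ ∷ [] , t′ ] (a ∷ b ∷ []) (a′ ∷ b′ ∷ []) u≢u′ p∈ p′∈ meet =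
      lose p∈ (lose p′∈ (x - x′ , y - y′ , ≢0 , meet⇒solved x y x′ y′ t t′ a b a′ b′ meet))
      where
      ≢0 : NonTrivial (x - x′) (y - y′)
      ≢0 (eq , eq′) = u≢u′ (cong₂ (λ i j → i ∷ j ∷ []) (i-j≡0⇒i≡j x x′ eq) (i-j≡0⇒i≡j y y′ eq′))

    noClash⇒nonOverlapping : (∀ t t′ → ¬ SuppClash t t′) → NonOverlapping σ
    noClash⇒nonOverlapping none P _ {c} {c′} c∈ c′∈ c≢c′ (path , _) {w} ωγ≡w {p} (p∈ , p∈′) =
      let p′ , p′∈ , p≡w+p′ = translate⁻ {S = cells (base (type c′))} w p∈′
          open IsPath path
          w≡ = just-injective (trans (sym ωγ≡w) (ω-position linked starts ends))
      in none (type c) (type c′) (meet⇒suppClash c c′ p p′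
        -- Distinct cells of one pattern have distinct vectors, even when their types agree.
        (c≢c′ ∘ unique-map⇒injective vector (distinct P) c∈ c′∈) p∈ p′∈
        (trans p≡w+p′ (cong (_+ᵥ p′) w≡)))

    -- Only finitely many pairs of types and of support vectors have to be searched.
    overlapping? : Dec (Overlapping σ)
    overlapping? with Fin.any? (λ t → Fin.any? (suppClash? t))
    ... | yes (_ , _ , clash) = yes (suppClash⇒overlapping clash)
    ... | no  noClash         = no λ overlapping →
      overlapping (noClash⇒nonOverlapping λ t t′ clash → noClash (t , t′ , clash))

theorem4p4 : ∀ {k : ℕ} (σ : Substitution 2 k) → Consistent σ → DominoComplete σ → Dec (Overlapping σ)
-- Over the empty alphabet there is no symbol to serve as `o`, but there are no cells either.
theorem4p4 {zero}  σ _          _        = no λ overlapping → overlapping λ { _ _ {[ _ , () ]} }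
theorem4p4 {suc k} σ consistent complete = overlapping?
  where open Consistency.Position σ consistent complete Fin.zero
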